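{- Let $N$ be a finite set and $f: 2^{N} \to \mathbb{R} \cup \{ -\infty\}$ an M$^\natural$-concave function. For any $X, Y \in \arg\max f$ and any $I \subseteq X \setminus Y$, there exists $J \subseteq Y \setminus X$ such that $(X \setminus I) \cup J \in \arg\max f$ and $(Y \setminus J) \cup I \in \arg\max f$.
   Context: $\arg\max f$ denotes the set of maximizers of $f$ over $2^N$. For $f: 2^N \to \mathbb{R}\cup\{ -\infty\}$, $\mathrm{dom}\, f = \{X \subseteq N : f(X) > -\infty\}$. Notation: $X - i = X \setminus \{i\}$, $Y + i = Y \cup \{i\}$, $X - i + j = (X\setminus\{i\})\cup\{j\}$, $Y + i - j = (Y \cup\{i\})\setminus\{j\}$. Conventions: $(-\infty)+a = a+(-\infty) = (-\infty)+(-\infty) = -\infty$ for $a \in \mathbb{R}$, $-\infty \le -\infty$, and a maximum over an empty set is $-\infty$. A function $f: 2^N \to \mathbb{R}\cup\{ -\infty\}$ with $\mathrm{dom}\, f \neq \emptyset$ is M$^\natural$-concave if for all $X, Y \subseteq N$ and $i \in X \setminus Y$: $$f(X)+f(Y) \le \max\Big[ f(X-i)+f(Y+i),\ \max_{j \in Y\setminus X}\{ f(X-i+j)+f(Y+i-j)\}\Big].$$ -}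

module Defs where

open import Data.Fin.Base using (Fin)
open import Data.Fin.Subset
  using (Subset; ⁅_⁆; _∪_; _─_; _-_) renaming (_∈_ to _∈ˢ_)
open import Data.Fin.Subset.Properties using (_∈?_)
open import Data.List.Base using (List; foldr; map; filter; allFin)
open import Data.Nat.Base as ℕ using (ℕ)
import Data.Nat.Properties as ℕ
open import Data.Product.Base using (_,_; ∃-syntax)
open import Data.Rational.Base as ℚ using (ℚ; 0ℚ; ½; ∣_∣)
import Data.Rational.Properties as ℚ
open import Data.Rational.Solver using (module +-*-Solver)
open import Data.Sum.Base using (inj₁; inj₂)
open import Level using (0ℓ)
open import Relation.Binary.Construct.Add.Infimum.NonStrict as Inf using ()
open import Relation.Binary.Core using (Rel)
open import Relation.Binary.PropositionalEquality
  using (_≡_; _≢_; refl; sym; trans; cong; subst; subst₂)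
open import Relation.Nullary.Construct.Add.Infimum using (_₋; ⊥₋; [_])
open import Relation.Unary using (Pred; Satisfiable)

private variable
  n : ℕ

private
  p≤∣p∣ : ∀ p → p ℚ.≤ ∣ p ∣
  p≤∣p∣ p with ℚ.≤-total 0ℚ p
  ... | inj₁ 0≤p = ℚ.≤-reflexive (sym (ℚ.0≤p⇒∣p∣≡p 0≤p))
  ... | inj₂ p≤0 = ℚ.≤-trans p≤0 (ℚ.0≤∣p∣ p)

  cancel : ∀ a c → (a ℚ.- c) ℚ.+ c ≡ a
  cancel = solve 2 (λ a c → (a :- c) :+ c := a) refl
    where open +-*-Solver

  -[a-c] : ∀ a c → ℚ.- (a ℚ.- c) ≡ c ℚ.- a
  -[a-c] = solve 2 (λ a c → :- (a :- c) := c :- a) refl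
    where open +-*-Solver

  near⇒≤ : ∀ a c {ε} → ∣ a ℚ.- c ∣ ℚ.≤ ε → a ℚ.≤ ε ℚ.+ c
  near⇒≤ a c {ε} h =
    subst (ℚ._≤ ε ℚ.+ c) (cancel a c)
      (ℚ.+-monoˡ-≤ c (ℚ.≤-trans (p≤∣p∣ (a ℚ.- c)) h))

  near-sym : ∀ a c {ε} → ∣ a ℚ.- c ∣ ℚ.≤ ε → ∣ c ℚ.- a ∣ ℚ.≤ ε
  near-sym a c {ε} = subst (ℚ._≤ ε)
    (trans (sym (ℚ.∣-p∣≡∣p∣ (a ℚ.- c))) (cong ∣_∣ (-[a-c] a c)))

  ≤⇒-≤ : ∀ a c ε → a ℚ.≤ ε ℚ.+ c → a ℚ.- c ℚ.≤ ε
  ≤⇒-≤ a c ε h = subst (a ℚ.- c ℚ.≤_) (eq ε c) (ℚ.+-monoˡ-≤ (ℚ.- c) h)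
    where
    open +-*-Solver
    eq : ∀ e c → (e ℚ.+ c) ℚ.- c ≡ e
    eq = solve 2 (λ e c → (e :+ c) :- c := e) refl

  ≤⇒near : ∀ a c ε → a ℚ.≤ ε ℚ.+ c → c ℚ.≤ ε ℚ.+ a → ∣ a ℚ.- c ∣ ℚ.≤ ε
  ≤⇒near a c ε h k with ℚ.∣p∣≡p∨∣p∣≡-p (a ℚ.- c)
  ... | inj₁ eq = subst (ℚ._≤ ε) (sym eq) (≤⇒-≤ a c ε h)
  ... | inj₂ eq = subst (ℚ._≤ ε) (sym (trans eq (-[a-c] a c))) (≤⇒-≤ c a ε k)

  ⊔-≤ : ∀ {a b} c d ε → a ℚ.≤ ε ℚ.+ c → b ℚ.≤ ε ℚ.+ d →
        a ℚ.⊔ b ℚ.≤ ε ℚ.+ (c ℚ.⊔ d)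
  ⊔-≤ c d ε p q = ℚ.⊔-lub
    (ℚ.≤-trans p (ℚ.+-monoʳ-≤ ε (ℚ.p≤p⊔q c d)))
    (ℚ.≤-trans q (ℚ.+-monoʳ-≤ ε (ℚ.p≤q⊔p c d)))

  ⊔-near : ∀ a b c d ε → ∣ a ℚ.- c ∣ ℚ.≤ ε → ∣ b ℚ.- d ∣ ℚ.≤ ε →
           ∣ (a ℚ.⊔ b) ℚ.- (c ℚ.⊔ d) ∣ ℚ.≤ ε
  ⊔-near a b c d ε h k = ≤⇒near (a ℚ.⊔ b) (c ℚ.⊔ d) ε
    (⊔-≤ c d ε (near⇒≤ a c h) (near⇒≤ b d k))
    (⊔-≤ a b ε (near⇒≤ c a (near-sym a c h)) (near⇒≤ d b (near-sym b d k)))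

  +-near : ∀ a b c d ε → ∣ a ℚ.- c ∣ ℚ.≤ ½ ℚ.* ε → ∣ b ℚ.- d ∣ ℚ.≤ ½ ℚ.* ε →
           ∣ (a ℚ.+ b) ℚ.- (c ℚ.+ d) ∣ ℚ.≤ ε
  +-near a b c d ε h k =
    subst₂ (λ p q → ∣ p ∣ ℚ.≤ q) (eq a b c d) (halves ε)
      (ℚ.≤-trans (ℚ.∣p+q∣≤∣p∣+∣q∣ (a ℚ.- c) (b ℚ.- d)) (ℚ.+-mono-≤ h k))
    where
    open +-*-Solver
    eq : ∀ a b c d → (a ℚ.- c) ℚ.+ (b ℚ.- d) ≡ (a ℚ.+ b) ℚ.- (c ℚ.+ d)
    eq = solve 4 (λ a b c d → (a :- c) :+ (b :- d) := (a :+ b) :- (c :+ d)) refl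
    halves : ∀ e → ½ ℚ.* e ℚ.+ ½ ℚ.* e ≡ e
    halves = solve 1 (λ e → con ½ :* e :+ con ½ :* e := e) refl

  ½*-pos : ∀ {ε} → 0ℚ ℚ.< ε → 0ℚ ℚ.< ½ ℚ.* ε
  ½*-pos {ε} 0<ε = subst (ℚ._< ½ ℚ.* ε) (ℚ.*-zeroʳ ½) (ℚ.*-monoʳ-<-pos ½ 0<ε)

-- Sequences are not quotiented: x and y are the same real number when
-- x ≤ᴿ y and y ≤ᴿ x, not when they are propositionally equal.

Cauchy : (ℕ → ℚ) → Set
Cauchy x = ∀ ε → 0ℚ ℚ.< ε →
  ∃[ N ] (∀ k l → N ℕ.≤ k → N ℕ.≤ l → ∣ x k ℚ.- x l ∣ ℚ.≤ ε)

record ℝ : Set where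
  constructor mkℝ
  field
    seq    : ℕ → ℚ
    cauchy : Cauchy seq

open ℝ public

infix  4 _≤ᴿ_
infixl 6 _+ᴿ_ _⊔ᴿ_

_≤ᴿ_ : Rel ℝ 0ℓ
x ≤ᴿ y = ∀ ε → 0ℚ ℚ.< ε → ∃[ N ] (∀ k → N ℕ.≤ k → seq x k ℚ.≤ seq y k ℚ.+ ε)

_+ᴿ_ : ℝ → ℝ → ℝ
seq    (x +ᴿ y) k = seq x k ℚ.+ seq y k
cauchy (x +ᴿ y) ε 0<ε with cauchy x (½ ℚ.* ε) (½*-pos 0<ε) | cauchy y (½ ℚ.* ε) (½*-pos 0<ε)
... | M , p | N , q = M ℕ.⊔ N , λ k l u v →
  +-near (seq x k) (seq y k) (seq x l) (seq y l) ε
    (p k l (ℕ.m⊔n≤o⇒m≤o M N u) (ℕ.m⊔n≤o⇒m≤o M N v))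
    (q k l (ℕ.m⊔n≤o⇒n≤o M N u) (ℕ.m⊔n≤o⇒n≤o M N v))

_⊔ᴿ_ : ℝ → ℝ → ℝ
seq    (x ⊔ᴿ y) k = seq x k ℚ.⊔ seq y k
cauchy (x ⊔ᴿ y) ε 0<ε with cauchy x ε 0<ε | cauchy y ε 0<ε
... | M , p | N , q = M ℕ.⊔ N , λ k l u v →
  ⊔-near (seq x k) (seq y k) (seq x l) (seq y l) ε
    (p k l (ℕ.m⊔n≤o⇒m≤o M N u) (ℕ.m⊔n≤o⇒m≤o M N v))
    (q k l (ℕ.m⊔n≤o⇒n≤o M N u) (ℕ.m⊔n≤o⇒n≤o M N v))

ℝ₋∞ : Set
ℝ₋∞ = ℝ ₋

-∞ : ℝ₋∞
-∞ = ⊥₋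

open Inf _≤ᴿ_ public using () renaming (_≤₋_ to infix 4 _≤_)

infixl 6 _+_ _⊔_

_+_ : ℝ₋∞ → ℝ₋∞ → ℝ₋∞
[ x ] + [ y ] = [ x +ᴿ y ]
[ x ] + ⊥₋    = -∞
⊥₋    + _     = -∞

_⊔_ : ℝ₋∞ → ℝ₋∞ → ℝ₋∞
[ x ] ⊔ [ y ] = [ x ⊔ᴿ y ]
[ x ] ⊔ ⊥₋    = [ x ]
⊥₋    ⊔ b     = b

max : List ℝ₋∞ → ℝ₋∞
max = foldr _⊔_ -∞

max-over : (Fin n → ℝ₋∞) → Subset n → ℝ₋∞
max-over {n} g S = max (map g (filter (_∈? S) (allFin n)))

syntax max-over (λ j → e) S = max[ j ∈ S ] e

dom : (Subset n → ℝ₋∞) → Pred (Subset n) 0ℓ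
dom f X = f X ≢ -∞

argmax : (Subset n → ℝ₋∞) → Pred (Subset n) 0ℓ
argmax f X = ∀ Z → f Z ≤ f X

record M♮-concave (f : Subset n → ℝ₋∞) : Set where
  field
    dom-nonempty : Satisfiable (dom f)
    exchange     : ∀ X Y i → i ∈ˢ (X ─ Y) →
      f X + f Y ≤
        (f (X - i) + f (Y ∪ ⁅ i ⁆))
        ⊔ max[ j ∈ Y ─ X ] (f ((X - i) ∪ ⁅ j ⁆) + f ((Y ∪ ⁅ i ⁆) - j))

{-# OPTIONS --safe #-}

-- The maximizers form a family B with a symmetric exchange property.  Adding
-- dummy elements that fill every member up to a common size turns B into the
-- bases of a matroid; there a set R together with m dummies has rank
-- max { |Z ∩ R| + min(m, |∁ Z|) : Z ∈ B }.  Contracting X ─ I, respectively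
-- (X ∩ Y) ∪ I, gives two submodular functions on (Y ─ X) plus |X ─ Y| dummies.
-- Their sum dominates the cardinality up to a constant, and by uncrossing the
-- elements can be assigned one at a time to either function without losing
-- this.  The resulting partition J, ∁ J attains both ranks, so the two
-- exchanged sets are themselves members of B.

module Submission where

module MultipleExchange where

  open import Axiom.ExcludedMiddle using (ExcludedMiddle)
  open import Data.Bool.Base using (Bool; true; false; T; not; _∧_; _∨_)
  open import Data.Bool.Properties using (T-∧)
  open import Data.Empty using (⊥; ⊥-elim)
  open import Data.Fin.Base using (Fin; zero; suc)
  open import Data.Fin.Subset hiding (⊤; ⊥)
  open import Data.Fin.Subset.Properties
  open import Data.List.Base using (List; []; _∷_)
  open import Data.Nat.Base
  open import Data.Nat.Properties
  open import Data.Nat.Tactic.RingSolver using (solve-∀)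
  open import Data.Product.Base using (_×_; _,_; ∃-syntax; proj₁; proj₂)
  open import Data.Sum.Base using (_⊎_; inj₁; inj₂)
  open import Data.Unit.Base using (⊤; tt)
  open import Data.Vec.Base as Vec using (Vec; []; _∷_; lookup; head; tail; here)
  open import Function.Base using (_∘_)
  open import Function.Bundles using (Equivalence)
  open import Level using (0ℓ)
  open import Relation.Binary.PropositionalEquality
  open import Relation.Nullary

  private variable
    m n : ℕ

  -- Linear inequalities between cardinalities, checked on truth tables.

  +-interchange : ∀ a b c d → (a + b) + (c + d) ≡ (a + c) + (b + d)
  +-interchange = solve-∀

  infixr 9 _:∩_
  infixr 8 _:∪_
  infixl 7 _:─_
  infix  6 _:⊆_

  data Expr (m : ℕ) : Set where
    var            : Fin m → Expr m
    ∁ᵉ             : Expr m → Expr m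
    _:∩_ _:∪_ _:─_ : Expr m → Expr m → Expr m

  ⟦_⟧ : Expr m → Vec (Subset n) m → Subset n
  ⟦ var x  ⟧ ρ = lookup ρ x
  ⟦ ∁ᵉ d   ⟧ ρ = ∁ (⟦ d ⟧ ρ)
  ⟦ d :∩ e ⟧ ρ = ⟦ d ⟧ ρ ∩ ⟦ e ⟧ ρ
  ⟦ d :∪ e ⟧ ρ = ⟦ d ⟧ ρ ∪ ⟦ e ⟧ ρ
  ⟦ d :─ e ⟧ ρ = ⟦ d ⟧ ρ ─ ⟦ e ⟧ ρ

  ⟦_⟧ᵇ : Expr m → Vec Bool m → Bool
  ⟦ var x  ⟧ᵇ ρ = lookup ρ x
  ⟦ ∁ᵉ d   ⟧ᵇ ρ = not (⟦ d ⟧ᵇ ρ)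
  ⟦ d :∩ e ⟧ᵇ ρ = ⟦ d ⟧ᵇ ρ ∧ ⟦ e ⟧ᵇ ρ
  ⟦ d :∪ e ⟧ᵇ ρ = ⟦ d ⟧ᵇ ρ ∨ ⟦ e ⟧ᵇ ρ
  ⟦ d :─ e ⟧ᵇ ρ = ⟦ d ⟧ᵇ ρ ∧ not (⟦ e ⟧ᵇ ρ)

  lookup-∷ : (ρ : Vec (Subset (suc n)) m) (x : Fin m) →
    lookup ρ x ≡ lookup (Vec.map head ρ) x ∷ lookup (Vec.map tail ρ) x
  lookup-∷ ((_ ∷ _) ∷ _) zero    = refl
  lookup-∷ (_ ∷ ρ)       (suc x) = lookup-∷ ρ x

  ─-∷ : ∀ x y (p q : Subset n) → (x ∷ p) ─ (y ∷ q) ≡ (x ∧ not y) ∷ (p ─ q)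
  ─-∷ true  true  p q = refl
  ─-∷ true  false p q = refl
  ─-∷ false true  p q = refl
  ─-∷ false false p q = refl

  ⟦⟧-∷ : (e : Expr m) (ρ : Vec (Subset (suc n)) m) →
    ⟦ e ⟧ ρ ≡ ⟦ e ⟧ᵇ (Vec.map head ρ) ∷ ⟦ e ⟧ (Vec.map tail ρ)
  ⟦⟧-∷ (var x)  ρ = lookup-∷ ρ x
  ⟦⟧-∷ (∁ᵉ d)   ρ = cong ∁ (⟦⟧-∷ d ρ)
  ⟦⟧-∷ (d :∩ e) ρ = cong₂ _∩_ (⟦⟧-∷ d ρ) (⟦⟧-∷ e ρ)
  ⟦⟧-∷ (d :∪ e) ρ = cong₂ _∪_ (⟦⟧-∷ d ρ) (⟦⟧-∷ e ρ)
  ⟦⟧-∷ (d :─ e) ρ = trans (cong₂ _─_ (⟦⟧-∷ d ρ) (⟦⟧-∷ e ρ)) (─-∷ (⟦ d ⟧ᵇ _) (⟦ e ⟧ᵇ _) _ _)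

  infixl 6 _:+_

  data Term (m : ℕ) : Set where
    ∣_∣ᵉ : Expr m → Term m
    _:+_ : Term m → Term m → Term m
    :0   : Term m

  ⟦_⟧ᵗ : Term m → Vec (Subset n) m → ℕ
  ⟦ ∣ e ∣ᵉ ⟧ᵗ ρ = ∣ ⟦ e ⟧ ρ ∣
  ⟦ s :+ t ⟧ᵗ ρ = ⟦ s ⟧ᵗ ρ + ⟦ t ⟧ᵗ ρ
  ⟦ :0     ⟧ᵗ ρ = 0

  indicator : Bool → ℕ
  indicator false = 0
  indicator true  = 1

  ⟦_⟧ᵗᵇ : Term m → Vec Bool m → ℕ
  ⟦ ∣ e ∣ᵉ ⟧ᵗᵇ ρ = indicator (⟦ e ⟧ᵇ ρ)
  ⟦ s :+ t ⟧ᵗᵇ ρ = ⟦ s ⟧ᵗᵇ ρ + ⟦ t ⟧ᵗᵇ ρ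
  ⟦ :0     ⟧ᵗᵇ ρ = 0

  ∣∷∣ : ∀ b (p : Subset n) → ∣ b ∷ p ∣ ≡ indicator b + ∣ p ∣
  ∣∷∣ true  p = refl
  ∣∷∣ false p = refl

  ⟦⟧ᵗ-∷ : (t : Term m) (ρ : Vec (Subset (suc n)) m) →
    ⟦ t ⟧ᵗ ρ ≡ ⟦ t ⟧ᵗᵇ (Vec.map head ρ) + ⟦ t ⟧ᵗ (Vec.map tail ρ)
  ⟦⟧ᵗ-∷ ∣ e ∣ᵉ   ρ = trans (cong ∣_∣ (⟦⟧-∷ e ρ)) (∣∷∣ (⟦ e ⟧ᵇ _) (⟦ e ⟧ (Vec.map tail ρ)))
  ⟦⟧ᵗ-∷ (s :+ t) ρ = trans (cong₂ _+_ (⟦⟧ᵗ-∷ s ρ) (⟦⟧ᵗ-∷ t ρ)) (+-interchange (⟦ s ⟧ᵗᵇ _) _ _ _)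
  ⟦⟧ᵗ-∷ :0       ρ = refl

  ⟦⟧ᵗ-[] : (t : Term m) (ρ : Vec (Subset 0) m) → ⟦ t ⟧ᵗ ρ ≡ 0
  ⟦⟧ᵗ-[] ∣ e ∣ᵉ   ρ with ⟦ e ⟧ ρ
  ... | [] = refl
  ⟦⟧ᵗ-[] (s :+ t) ρ = cong₂ _+_ (⟦⟧ᵗ-[] s ρ) (⟦⟧ᵗ-[] t ρ)
  ⟦⟧ᵗ-[] :0       ρ = refl

  data Inclusion (m : ℕ) : Set where
    _:⊆_ : Expr m → Expr m → Inclusion m

  Hyps : List (Inclusion m) → Vec (Subset n) m → Set
  Hyps []             ρ = ⊤
  Hyps (d :⊆ e ∷ hs) ρ = (⟦ d ⟧ ρ ⊆ ⟦ e ⟧ ρ) × Hyps hs ρ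

  hyps : List (Inclusion m) → Vec Bool m → Bool
  hyps []             ρ = true
  hyps (d :⊆ e ∷ hs) ρ = (not (⟦ d ⟧ᵇ ρ) ∨ ⟦ e ⟧ᵇ ρ) ∧ hyps hs ρ

  hyps-head : (hs : List (Inclusion m)) (ρ : Vec (Subset (suc n)) m) →
    Hyps hs ρ → T (hyps hs (Vec.map head ρ))
  hyps-head []              ρ _         = tt
  hyps-head (d :⊆ e ∷ hs) ρ (h , hρ) = Equivalence.from T-∧
    (sub _ _ (subst₂ _⊆_ (⟦⟧-∷ d ρ) (⟦⟧-∷ e ρ) h) , hyps-head hs ρ hρ)
    where
    sub : ∀ x y {p q : Subset n} → (x ∷ p) ⊆ (y ∷ q) → T (not x ∨ y)
    sub false y     _   = tt
    sub true  true  _   = tt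
    sub true  false x⊆y with x⊆y here
    ... | ()

  hyps-tail : (hs : List (Inclusion m)) (ρ : Vec (Subset (suc n)) m) →
    Hyps hs ρ → Hyps hs (Vec.map tail ρ)
  hyps-tail []              ρ _         = tt
  hyps-tail (d :⊆ e ∷ hs) ρ (h , hρ) =
    drop-∷-⊆ (subst₂ _⊆_ (⟦⟧-∷ d ρ) (⟦⟧-∷ e ρ) h) , hyps-tail hs ρ hρ

  everywhere : ∀ m → (Vec Bool m → Bool) → Bool
  everywhere zero    P = P []
  everywhere (suc m) P = everywhere m (P ∘ (false ∷_)) ∧ everywhere m (P ∘ (true ∷_))

  everywhere-sound : ∀ m (P : Vec Bool m → Bool) → T (everywhere m P) → ∀ ρ → T (P ρ)
  everywhere-sound zero    P h [] = h
  everywhere-sound (suc m) P h (false ∷ ρ) = everywhere-sound m _ (proj₁ (Equivalence.to T-∧ h)) ρ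
  everywhere-sound (suc m) P h (true  ∷ ρ) = everywhere-sound m _ (proj₂ (Equivalence.to T-∧ h)) ρ

  -- Boolean-valued, so that on closed expressions `T (everywhere m (holds hs s t))` computes to the
  -- unit type and is filled in without a written proof.
  holds : List (Inclusion m) → Term m → Term m → Vec Bool m → Bool
  holds hs s t ρ = not (hyps hs ρ) ∨ (⟦ s ⟧ᵗᵇ ρ ≤ᵇ ⟦ t ⟧ᵗᵇ ρ)

  -- Cardinality is a sum over the ground set, so a linear inequality between
  -- the sizes of Boolean combinations may be checked at one element, that is,
  -- on finitely many truth assignments.
  count-≤ : ∀ {m} (hs : List (Inclusion m)) (s t : Term m) {_ : T (everywhere m (holds hs s t))} →
    ∀ {n} (ρ : Vec (Subset n) m) → Hyps hs ρ → ⟦ s ⟧ᵗ ρ ≤ ⟦ t ⟧ᵗ ρ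
  count-≤ hs s t {h} {zero}  ρ hρ = ≤-reflexive (trans (⟦⟧ᵗ-[] s ρ) (sym (⟦⟧ᵗ-[] t ρ)))
  count-≤ hs s t {h} {suc n} ρ hρ = subst₂ _≤_ (sym (⟦⟧ᵗ-∷ s ρ)) (sym (⟦⟧ᵗ-∷ t ρ))
    (+-mono-≤ (implies (hyps hs _) (hyps-head hs ρ hρ) (everywhere-sound _ (holds hs s t) h (Vec.map head ρ)))
              (count-≤ hs s t {h} (Vec.map tail ρ) (hyps-tail hs ρ hρ)))
    where
    implies : ∀ b {k l} → T b → T (not b ∨ (k ≤ᵇ l)) → k ≤ l
    implies true _ h = ≤ᵇ⇒≤ _ _ h

  pattern #0 = var zero
  pattern #1 = var (suc zero)
  pattern #2 = var (suc (suc zero))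
  pattern #3 = var (suc (suc (suc zero)))
  pattern #4 = var (suc (suc (suc (suc zero))))

  -- Singletons and truncated sums.

  ⁅⁆⊆ : ∀ {i} {p : Subset n} → i ∈ p → ⁅ i ⁆ ⊆ p
  ⁅⁆⊆ {i = i} {p} i∈p x∈ = subst (_∈ p) (sym (x∈⁅y⁆⇒x≡y i x∈)) i∈p

  Empty─⇒⊆ : ∀ {p q : Subset n} → Empty (p ─ q) → p ⊆ q
  Empty─⇒⊆ {p = p} {q} p─q=∅ {x} x∈p with x ∈? q
  ... | yes x∈q = x∈q
  ... | no  x∉q = contradiction (x , x∈p∧x∉q⇒x∈p─q x∈p x∉q) p─q=∅

  a+∣⁅i⁆∣≤b⇒a<b : ∀ {a b} (i : Fin n) → a + ∣ ⁅ i ⁆ ∣ ≤ b → a < b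
  a+∣⁅i⁆∣≤b⇒a<b {a = a} {b} i = subst (_≤ b) (trans (cong (a +_) (∣⁅x⁆∣≡1 i)) (+-comm a 1))

  cancel-⁅⁆ : ∀ {a b} (i j : Fin n) → a + ∣ ⁅ j ⁆ ∣ ≤ b + ∣ ⁅ i ⁆ ∣ → a ≤ b
  cancel-⁅⁆ {a = a} {b} i j h = +-cancelʳ-≤ 1 a b
    (subst₂ (λ k l → a + k ≤ b + l) (∣⁅x⁆∣≡1 j) (∣⁅x⁆∣≡1 i) h)

  a≤b+∣⁅i⁆∣⇒a≤1+b : ∀ {a b} (i : Fin n) → a ≤ b + ∣ ⁅ i ⁆ ∣ → a ≤ suc b
  a≤b+∣⁅i⁆∣⇒a≤1+b {a = a} {b} i = subst (a ≤_) (trans (cong (b +_) (∣⁅x⁆∣≡1 i)) (+-comm b 1))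

  ⊓-suc : ∀ k {c c′} → c ≤ suc c′ → k ⊓ c ≤ suc (k ⊓ c′)
  ⊓-suc k {c} {c′} h = ⊓-mono-≤ (n≤1+n k) h

  +⊓-gain : ∀ k {a a′ c c′} → suc a ≤ a′ → c ≤ suc c′ → a + (k ⊓ c) ≤ a′ + (k ⊓ c′)
  +⊓-gain k {a} {a′} {c} {c′} a<a′ c≤ = begin
    a + (k ⊓ c)        ≤⟨ +-monoʳ-≤ a (⊓-suc k c≤) ⟩
    a + suc (k ⊓ c′)   ≡⟨ +-suc a _ ⟩
    suc a + (k ⊓ c′)   ≤⟨ +-monoˡ-≤ _ a<a′ ⟩
    a′ + (k ⊓ c′)      ∎
    where open ≤-Reasoning

  -- The bound `c′ ≤ k` keeps the second minimum untruncated, so the growth of `c` pays for the unit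
  -- that `a` may lose.
  +⊓-loss : ∀ k {a a′ c c′} → a ≤ suc a′ → suc c ≤ c′ → c′ ≤ k → a + (k ⊓ c) ≤ a′ + (k ⊓ c′)
  +⊓-loss k {a} {a′} {c} {c′} a≤ c< c′≤k = begin
    a + (k ⊓ c)      ≤⟨ +-mono-≤ a≤ (m⊓n≤n k c) ⟩
    suc a′ + c       ≡⟨ +-suc a′ c ⟨
    a′ + suc c       ≤⟨ +-monoʳ-≤ a′ c< ⟩
    a′ + c′          ≡⟨ cong (a′ +_) (m≥n⇒m⊓n≡n c′≤k) ⟨
    a′ + (k ⊓ c′)    ∎
    where open ≤-Reasoning

  -- One member attaining the rank of two nested sets.

  distᵗ : Expr m → Expr m → Term m
  distᵗ x y = ∣ x :─ y ∣ᵉ :+ ∣ y :─ x ∣ᵉ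

  -- The part of the base (Z, dummies) that lies in R and m of the dummies, when
  -- Z is filled up with |∁ Z| interchangeable dummies.
  ψ : Subset n → ℕ → Subset n → ℕ
  ψ R m Z = ∣ Z ∩ R ∣ + (m ⊓ ∣ ∁ Z ∣)

  -- This is the exchange condition of M♮-concavity for the function that is 0 on `B` and -∞
  -- elsewhere. Nonempty families of this kind are known as generalized matroids.
  Exchange : (Subset n → Set) → Set
  Exchange {n} B = ∀ {X Y} → B X → B Y → ∀ i → i ∈ (X ─ Y) →
    (B (X - i) × B (Y ∪ ⁅ i ⁆)) ⊎
    ∃[ j ] (j ∈ (Y ─ X) × B ((X - i) ∪ ⁅ j ⁆) × B ((Y ∪ ⁅ i ⁆) - j))

  module _ {B : Subset n → Set} (exchange : Exchange B)
           {R U : Subset n} (R⊆U : R ⊆ U) {m m′ : ℕ} (m≤m′ : m ≤ m′) where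

    distance : Subset n → Subset n → ℕ
    distance Z₁ Z₂ = ∣ Z₁ ─ Z₂ ∣ + ∣ Z₂ ─ Z₁ ∣

    value : Subset n → Subset n → ℕ
    value Z₁ Z₂ = ψ R m Z₁ + ψ U m′ Z₂

    Step : Subset n → Subset n → Set
    Step Z₁ Z₂ = ∃[ W₁ ] ∃[ W₂ ] (B W₁ × B W₂ ×
      distance W₁ W₂ < distance Z₁ Z₂ × value Z₁ Z₂ ≤ value W₁ W₂)

    -- A swap keeps the size, hence the dummies. Changing `Z₁` costs something only if `i` is in `R`
    -- and `j` is not; then `i` is also in `U`, and changing `Z₂` instead costs nothing there.
    swap-step : ∀ {Z₁ Z₂ i j} → B Z₁ → B Z₂ → i ∈ Z₁ ─ Z₂ → j ∈ Z₂ ─ Z₁ →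
      B ((Z₁ - i) ∪ ⁅ j ⁆) → B ((Z₂ ∪ ⁅ i ⁆) - j) → Step Z₁ Z₂
    swap-step {Z₁} {Z₂} {i} {j} b₁ b₂ i∈ j∈ b₁′ b₂′ = cases (j ∈? R) (i ∈? R)
      where
      ρ : Vec (Subset n) 5
      ρ = Z₁ ∷ Z₂ ∷ ⁅ i ⁆ ∷ ⁅ j ⁆ ∷ R ∷ []

      W₁ᵉ W₂ᵉ : Expr 5
      W₁ᵉ = (#0 :─ #2) :∪ #3
      W₂ᵉ = (#1 :∪ #2) :─ #3

      H : List (Inclusion 5)
      H = #2 :⊆ #0 :─ #1 ∷ #3 :⊆ #1 :─ #0 ∷ []

      h : Hyps H ρ
      h = ⁅⁆⊆ i∈ , ⁅⁆⊆ j∈ , tt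

      left : ∣ Z₁ ∩ R ∣ ≤ ∣ ((Z₁ - i) ∪ ⁅ j ⁆) ∩ R ∣ → Step Z₁ Z₂
      left le = _ , _ , b₁′ , b₂ ,
        a+∣⁅i⁆∣≤b⇒a<b i (count-≤ H (distᵗ W₁ᵉ #1 :+ ∣ #2 ∣ᵉ) (distᵗ #0 #1) ρ h) ,
        +-monoˡ-≤ (ψ U m′ Z₂) (+-mono-≤ le
          (⊓-monoʳ-≤ m (cancel-⁅⁆ j i (count-≤ H (∣ ∁ᵉ #0 ∣ᵉ :+ ∣ #2 ∣ᵉ) (∣ ∁ᵉ W₁ᵉ ∣ᵉ :+ ∣ #3 ∣ᵉ) ρ h))))

      right : ∣ Z₂ ∩ U ∣ ≤ ∣ ((Z₂ ∪ ⁅ i ⁆) - j) ∩ U ∣ → Step Z₁ Z₂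
      right le = _ , _ , b₁ , b₂′ ,
        a+∣⁅i⁆∣≤b⇒a<b i (count-≤ H (distᵗ #0 W₂ᵉ :+ ∣ #2 ∣ᵉ) (distᵗ #0 #1) ρ h) ,
        +-monoʳ-≤ (ψ R m Z₁) (+-mono-≤ le
          (⊓-monoʳ-≤ m′ (cancel-⁅⁆ i j (count-≤ H (∣ ∁ᵉ #1 ∣ᵉ :+ ∣ #3 ∣ᵉ) (∣ ∁ᵉ W₂ᵉ ∣ᵉ :+ ∣ #2 ∣ᵉ) ρ h))))

      cases : Dec (j ∈ R) → Dec (i ∈ R) → Step Z₁ Z₂
      cases (yes j∈R) _ = left (cancel-⁅⁆ i j (count-≤ (#3 :⊆ #4 ∷ H)
        (∣ #0 :∩ #4 ∣ᵉ :+ ∣ #3 ∣ᵉ) (∣ W₁ᵉ :∩ #4 ∣ᵉ :+ ∣ #2 ∣ᵉ) ρ (⁅⁆⊆ j∈R , h)))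
      cases (no _) (no i∉R) = left (count-≤ (#2 :⊆ ∁ᵉ #4 ∷ H)
        ∣ #0 :∩ #4 ∣ᵉ ∣ W₁ᵉ :∩ #4 ∣ᵉ ρ (⁅⁆⊆ (x∉p⇒x∈∁p i∉R) , h))
      cases (no _) (yes i∈R) = right (cancel-⁅⁆ j i (count-≤ (#2 :⊆ #4 ∷ H)
        (∣ #1 :∩ #4 ∣ᵉ :+ ∣ #2 ∣ᵉ) (∣ W₂ᵉ :∩ #4 ∣ᵉ :+ ∣ #3 ∣ᵉ)
        (Z₁ ∷ Z₂ ∷ ⁅ i ⁆ ∷ ⁅ j ⁆ ∷ U ∷ []) (⁅⁆⊆ (R⊆U i∈R) , h)))

    -- If `i` is in `U`, adding it to `Z₂` gains one element and loses at most one dummy. Otherwise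
    -- it is not in `R` either, and `Z₁` can drop it for free.
    single-step : ∀ {Z₁ Z₂ i} → B Z₁ → B Z₂ → i ∈ Z₁ ─ Z₂ →
      B (Z₁ - i) → B (Z₂ ∪ ⁅ i ⁆) → Step Z₁ Z₂
    single-step {Z₁} {Z₂} {i} b₁ b₂ i∈ b₁′ b₂′ = cases (i ∈? U)
      where
      ρ : Vec (Subset n) 5
      ρ = Z₁ ∷ Z₂ ∷ ⁅ i ⁆ ∷ R ∷ U ∷ []

      W₁ᵉ W₂ᵉ : Expr 5
      W₁ᵉ = #0 :─ #2
      W₂ᵉ = #1 :∪ #2

      H : List (Inclusion 5)
      H = #2 :⊆ #0 :─ #1 ∷ #3 :⊆ #4 ∷ []

      h : Hyps H ρ
      h = ⁅⁆⊆ i∈ , R⊆U , tt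

      cases : Dec (i ∈ U) → Step Z₁ Z₂
      cases (yes i∈U) = _ , _ , b₁ , b₂′ ,
        a+∣⁅i⁆∣≤b⇒a<b i (count-≤ H (distᵗ #0 W₂ᵉ :+ ∣ #2 ∣ᵉ) (distᵗ #0 #1) ρ h) ,
        +-monoʳ-≤ (ψ R m Z₁) (+⊓-gain m′
          (a+∣⁅i⁆∣≤b⇒a<b i (count-≤ (#2 :⊆ #4 ∷ H) (∣ #1 :∩ #4 ∣ᵉ :+ ∣ #2 ∣ᵉ) ∣ W₂ᵉ :∩ #4 ∣ᵉ ρ (⁅⁆⊆ i∈U , h)))
          (a≤b+∣⁅i⁆∣⇒a≤1+b i (count-≤ H ∣ ∁ᵉ #1 ∣ᵉ (∣ ∁ᵉ W₂ᵉ ∣ᵉ :+ ∣ #2 ∣ᵉ) ρ h)))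
      cases (no i∉U) = _ , _ , b₁′ , b₂ ,
        a+∣⁅i⁆∣≤b⇒a<b i (count-≤ H (distᵗ W₁ᵉ #1 :+ ∣ #2 ∣ᵉ) (distᵗ #0 #1) ρ h) ,
        +-monoˡ-≤ (ψ U m′ Z₂) (+-mono-≤
          (count-≤ (#2 :⊆ ∁ᵉ #4 ∷ H) ∣ #0 :∩ #3 ∣ᵉ ∣ W₁ᵉ :∩ #3 ∣ᵉ ρ (⁅⁆⊆ (x∉p⇒x∈∁p i∉U) , h))
          (⊓-monoʳ-≤ m (count-≤ H ∣ ∁ᵉ #0 ∣ᵉ ∣ ∁ᵉ W₁ᵉ ∣ᵉ ρ h)))

    -- The question is whether the dummies available to `Z₁` exceed `m`. If so, adding `i` to `Z₁`
    -- leaves the truncated count at `m`. If not, the still smaller complement of `Z₂ - i` stays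
    -- within `m′`, so the new dummy makes up for losing `i`.
    nested-step : ∀ {Z₁ Z₂ i} → B Z₁ → B Z₂ → Z₁ ⊆ Z₂ → i ∈ Z₂ ─ Z₁ →
      B (Z₂ - i) → B (Z₁ ∪ ⁅ i ⁆) → Step Z₁ Z₂
    nested-step {Z₁} {Z₂} {i} b₁ b₂ Z₁⊆Z₂ i∈ b₂′ b₁′ = cases (∣ ∁ Z₁ ∣ ≤? m)
      where
      ρ : Vec (Subset n) 4
      ρ = Z₁ ∷ Z₂ ∷ ⁅ i ⁆ ∷ R ∷ []

      W₁ᵉ W₂ᵉ : Expr 4
      W₁ᵉ = #0 :∪ #2
      W₂ᵉ = #1 :─ #2

      H : List (Inclusion 4)
      H = #2 :⊆ #1 :─ #0 ∷ #0 :⊆ #1 ∷ []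

      h : Hyps H ρ
      h = ⁅⁆⊆ i∈ , Z₁⊆Z₂ , tt

      cases : Dec (∣ ∁ Z₁ ∣ ≤ m) → Step Z₁ Z₂
      cases (yes ∁Z₁≤m) = _ , _ , b₁ , b₂′ ,
        a+∣⁅i⁆∣≤b⇒a<b i (count-≤ H (distᵗ #0 W₂ᵉ :+ ∣ #2 ∣ᵉ) (distᵗ #0 #1) ρ h) ,
        +-monoʳ-≤ (ψ R m Z₁) (+⊓-loss m′
          (a≤b+∣⁅i⁆∣⇒a≤1+b i (count-≤ H ∣ #1 :∩ #3 ∣ᵉ (∣ W₂ᵉ :∩ #3 ∣ᵉ :+ ∣ #2 ∣ᵉ) (Z₁ ∷ Z₂ ∷ ⁅ i ⁆ ∷ U ∷ []) h))
          (a+∣⁅i⁆∣≤b⇒a<b i (count-≤ H (∣ ∁ᵉ #1 ∣ᵉ :+ ∣ #2 ∣ᵉ) ∣ ∁ᵉ W₂ᵉ ∣ᵉ ρ h))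
          (≤-trans (count-≤ H ∣ ∁ᵉ W₂ᵉ ∣ᵉ ∣ ∁ᵉ #0 ∣ᵉ ρ h) (≤-trans ∁Z₁≤m m≤m′)))
      cases (no ∁Z₁≰m) = _ , _ , b₁′ , b₂ ,
        a+∣⁅i⁆∣≤b⇒a<b i (count-≤ H (distᵗ W₁ᵉ #1 :+ ∣ #2 ∣ᵉ) (distᵗ #0 #1) ρ h) ,
        +-monoˡ-≤ (ψ U m′ Z₂) (+-mono-≤
          (count-≤ H ∣ #0 :∩ #3 ∣ᵉ ∣ W₁ᵉ :∩ #3 ∣ᵉ ρ h)
          (≤-trans (m⊓n≤m m _) (⊓-glb ≤-refl (s≤s⁻¹ (≤-trans (≰⇒> ∁Z₁≰m)
            (a≤b+∣⁅i⁆∣⇒a≤1+b i (count-≤ H ∣ ∁ᵉ #0 ∣ᵉ (∣ ∁ᵉ W₁ᵉ ∣ᵉ :+ ∣ #2 ∣ᵉ) ρ h)))))))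

    -- An element of Z₁ ─ Z₂ is exchanged first: a single element of Z₂ ─ Z₁ can
    -- be moved at no loss once Z₁ ⊆ Z₂, but not in general.
    step : ∀ {Z₁ Z₂} → B Z₁ → B Z₂ → Z₁ ≡ Z₂ ⊎ Step Z₁ Z₂
    step {Z₁} {Z₂} b₁ b₂ with nonempty? (Z₁ ─ Z₂)
    step {Z₁} {Z₂} b₁ b₂ | yes (i , i∈) with exchange b₁ b₂ i i∈
    ... | inj₁ (b₁′ , b₂′)          = inj₂ (single-step b₁ b₂ i∈ b₁′ b₂′)
    ... | inj₂ (j , j∈ , b₁′ , b₂′) = inj₂ (swap-step b₁ b₂ i∈ j∈ b₁′ b₂′)
    step {Z₁} {Z₂} b₁ b₂ | no Z₁─Z₂=∅ with nonempty? (Z₂ ─ Z₁)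
    ... | no Z₂─Z₁=∅ = inj₁ (⊆-antisym (Empty─⇒⊆ Z₁─Z₂=∅) (Empty─⇒⊆ Z₂─Z₁=∅))
    ... | yes (i , i∈) with exchange b₂ b₁ i i∈
    ...   | inj₁ (b₂′ , b₁′)  = inj₂ (nested-step b₁ b₂ (Empty─⇒⊆ Z₁─Z₂=∅) i∈ b₂′ b₁′)
    ...   | inj₂ (j , j∈ , _) = contradiction (j , j∈) Z₁─Z₂=∅

    -- In matroid terms, two nested sets have a common base attaining both ranks. Each step brings
    -- the two members closer without lowering the value, until they coincide.
    merge : ∀ {Z₁ Z₂} → B Z₁ → B Z₂ → ∃[ Z ] (B Z × value Z₁ Z₂ ≤ value Z Z)
    merge b₁ b₂ = go _ b₁ b₂ ≤-refl
      where
      go : ∀ k {Z₁ Z₂} → B Z₁ → B Z₂ → distance Z₁ Z₂ < k → ∃[ Z ] (B Z × value Z₁ Z₂ ≤ value Z Z)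
      go (suc k) b₁ b₂ d<1+k with step b₁ b₂
      ... | inj₁ refl = _ , b₁ , ≤-refl
      ... | inj₂ (W₁ , W₂ , c₁ , c₂ , d′<d , v≤v′) with go k c₁ c₂ (≤-trans d′<d (s≤s⁻¹ d<1+k))
      ...   | Z , b , v′≤v = Z , b , ≤-trans v≤v′ v′≤v

  -- Partitioning a ground set between two submodular functions.

  -- The maximum of g p over p is then submodular; stating it with witnesses
  -- avoids forming maxima.
  Submodular : {P : Set} → (P → Subset n → ℕ) → Set
  Submodular g = ∀ S T p q → ∃[ r ] g p (S ∩ T) + g q (S ∪ T) ≤ g r S + g r T

  indicator≤1 : ∀ b → indicator b ≤ 1
  indicator≤1 true  = ≤-refl
  indicator≤1 false = z≤n

  module _ (em : ExcludedMiddle 0ℓ) {P Q : Set} where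

    -- The constant `c` absorbs the elements of `W` already assigned, which keeps the form of the
    -- condition stable under induction on the ground set.
    Sufficient : (P → Subset n → ℕ) → (Q → Subset n → ℕ) → Subset n → ℕ → Set
    Sufficient g h W c = ∀ S → ∃[ p ] ∃[ q ] ∣ S ∩ W ∣ + c ≤ g p S + h q S

    insufficient : (g : P → Subset n → ℕ) (h : Q → Subset n → ℕ) (W : Subset n) (c : ℕ) →
      ¬ Sufficient g h W c → ∃[ S ] (∀ p q → g p S + h q S < ∣ S ∩ W ∣ + c)
    insufficient g h W c ¬suff with em {∃[ S ] (∀ p q → g p S + h q S < ∣ S ∩ W ∣ + c)}
    ... | yes bad  = bad
    ... | no  ¬bad = contradiction suff ¬suff
      where
      suff : Sufficient g h W c
      suff S with em {∃[ p ] ∃[ q ] ∣ S ∩ W ∣ + c ≤ g p S + h q S}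
      ... | yes good  = good
      ... | no  ¬good = contradiction (S , λ p q → ≰⇒> λ le → ¬good (p , q , le)) ¬bad

    -- The two strict failures together leave a deficit of 2. The current element is counted in both
    -- failures but in only one of the two sufficient sets, and this accounts for just `b ≤ 1` of
    -- it.
    uncross : ∀ {b c m₁ m₂ s t g₁ g₂ h₁ h₂ u₁ u₂ v₁ v₂} → b ≤ 1 → s + t ≤ m₂ + m₁ →
      (b + m₁) + c ≤ g₁ + h₁ → m₂ + c ≤ g₂ + h₂ →
      g₂ + g₁ ≤ u₁ + u₂ → h₂ + h₁ ≤ v₁ + v₂ →
      u₁ + v₁ < s + (b + c) → u₂ + v₂ < t + (b + c) → ⊥
    uncross {b} {c} {m₁} {m₂} {s} {t} {g₁} {g₂} {h₁} {h₂} {u₁} {u₂} {v₁} {v₂}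
      b≤1 mod c₁ c₂ sg sh f₁ f₂ = <-irrefl refl (begin-strict
        1 + ((u₁ + v₁) + (u₂ + v₂))             <⟨ ≤-refl ⟩
        2 + ((u₁ + v₁) + (u₂ + v₂))             ≡⟨ e₁ (u₁ + v₁) (u₂ + v₂) ⟩
        suc (u₁ + v₁) + suc (u₂ + v₂)           ≤⟨ +-mono-≤ f₁ f₂ ⟩
        (s + (b + c)) + (t + (b + c))           ≡⟨ e₂ s t b c ⟩
        (s + t) + ((b + b) + (c + c))           ≤⟨ +-monoˡ-≤ _ mod ⟩
        (m₂ + m₁) + ((b + b) + (c + c))         ≡⟨ e₃ m₁ m₂ b c ⟩
        b + (((b + m₁) + c) + (m₂ + c))         ≤⟨ +-monoʳ-≤ b (+-mono-≤ c₁ c₂) ⟩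
        b + ((g₁ + h₁) + (g₂ + h₂))             ≡⟨ e₄ b g₁ h₁ g₂ h₂ ⟩
        b + ((g₂ + g₁) + (h₂ + h₁))             ≤⟨ +-mono-≤ b≤1 (+-mono-≤ sg sh) ⟩
        1 + ((u₁ + u₂) + (v₁ + v₂))             ≡⟨ e₅ u₁ u₂ v₁ v₂ ⟩
        1 + ((u₁ + v₁) + (u₂ + v₂))             ∎)
      where
      open ≤-Reasoning
      e₁ : ∀ x y → 2 + (x + y) ≡ (1 + x) + (1 + y)
      e₁ = solve-∀
      e₂ : ∀ s t b c → (s + (b + c)) + (t + (b + c)) ≡ (s + t) + ((b + b) + (c + c))
      e₂ = solve-∀
      e₃ : ∀ x y b c → (y + x) + ((b + b) + (c + c)) ≡ b + (((b + x) + c) + (y + c))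
      e₃ = solve-∀
      e₄ : ∀ b x y z w → b + ((x + y) + (z + w)) ≡ b + ((z + x) + (w + y))
      e₄ = solve-∀
      e₅ : ∀ x y z w → 1 + ((x + y) + (z + w)) ≡ 1 + ((x + z) + (y + w))
      e₅ = solve-∀

    -- If the first element could be assigned to neither g nor h, sets S and T
    -- witnessing this would violate sufficiency at S ∪ T with the element or at
    -- S ∩ T without it.
    split : (g : P → Subset n → ℕ) (h : Q → Subset n → ℕ) → Submodular g → Submodular h →
      ∀ W c → Sufficient g h W c → ∃[ J ] ∃[ p ] ∃[ q ] ∣ W ∣ + c ≤ g p J + h q (∁ J)
    split g h g-sub h-sub [] c suff with suff []
    ... | p , q , le = [] , p , q , le
    split {suc n} g h g-sub h-sub (w ∷ W) c suff = cases em em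
      where
      restrict : {R : Set} → Bool → (R → Subset (suc n) → ℕ) → R → Subset n → ℕ
      restrict b k r S = k r (b ∷ S)

      restrict-sub : ∀ {R : Set} (k : R → Subset (suc n) → ℕ) b → Submodular k → Submodular (restrict b k)
      restrict-sub k true  k-sub S T = k-sub (true ∷ S) (true ∷ T)
      restrict-sub k false k-sub S T = k-sub (false ∷ S) (false ∷ T)

      extend : ∀ {k} → ∣ W ∣ + (indicator w + c) ≤ k → ∣ w ∷ W ∣ + c ≤ k
      extend {k} = subst (_≤ k) (trans (e ∣ W ∣ (indicator w) c) (cong (_+ c) (sym (∣∷∣ w W))))
        where
        e : ∀ x y z → x + (y + z) ≡ (y + x) + z
        e = solve-∀

      cases : Dec (Sufficient (restrict true g) (restrict false h) W (indicator w + c)) →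
              Dec (Sufficient (restrict false g) (restrict true h) W (indicator w + c)) →
              ∃[ J ] ∃[ p ] ∃[ q ] ∣ w ∷ W ∣ + c ≤ g p J + h q (∁ J)
      cases (yes suff′) _
        with split (restrict true g) (restrict false h) (restrict-sub g true g-sub) (restrict-sub h false h-sub) W _ suff′
      ... | J , p , q , le = true ∷ J , p , q , extend le
      cases (no _) (yes suff′)
        with split (restrict false g) (restrict true h) (restrict-sub g false g-sub) (restrict-sub h true h-sub) W _ suff′
      ... | J , p , q , le = false ∷ J , p , q , extend le
      cases (no ¬suff₁) (no ¬suff₂)
        with insufficient (restrict true g) (restrict false h) W _ ¬suff₁
           | insufficient (restrict false g) (restrict true h) W _ ¬suff₂
      ... | S , S-bad | T , T-bad
        with suff (true ∷ (S ∪ T)) | suff (false ∷ (S ∩ T))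
      ... | p₁ , q₁ , le₁ | p₂ , q₂ , le₂
        -- Both pairs have intersection `false ∷ (S ∩ T)` and union `true ∷ (S ∪ T)`, though `g` and
        -- `h` place the first element in different sets.
        with g-sub (true ∷ S) (false ∷ T) p₂ p₁ | h-sub (false ∷ S) (true ∷ T) q₂ q₁
      ... | r , sg | r′ , sh = ⊥-elim
        (uncross {m₁ = ∣ (S ∪ T) ∩ W ∣} {∣ (S ∩ T) ∩ W ∣} {∣ S ∩ W ∣} {∣ T ∩ W ∣}
          {g p₁ (true ∷ (S ∪ T))} {g p₂ (false ∷ (S ∩ T))}
          {h q₁ (true ∷ (S ∪ T))} {h q₂ (false ∷ (S ∩ T))}
          {g r (true ∷ S)} {g r (false ∷ T)} {h r′ (false ∷ S)} {h r′ (true ∷ T)} (indicator≤1 w)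
          (count-≤ [] (∣ #0 :∩ #2 ∣ᵉ :+ ∣ #1 :∩ #2 ∣ᵉ)
            (∣ (#0 :∩ #1) :∩ #2 ∣ᵉ :+ ∣ (#0 :∪ #1) :∩ #2 ∣ᵉ) (S ∷ T ∷ W ∷ []) tt)
          (subst (λ k → k + c ≤ _) (∣∷∣ w ((S ∪ T) ∩ W)) le₁) le₂ sg sh (S-bad r r′) (T-bad r r′))

  -- Submodular rank functions of an exchange family.

  ∣p─q∣≤0⇒p⊆q : ∀ {p q : Subset n} → ∣ p ─ q ∣ ≤ 0 → p ⊆ q
  ∣p─q∣≤0⇒p⊆q le = Empty─⇒⊆ λ (x , x∈) →
    1+n≰n (≤-trans (subst (_≤ _) (∣⁅x⁆∣≡1 x) (p⊆q⇒∣p∣≤∣q∣ (⁅⁆⊆ x∈))) le)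

  -- Truncation at `c` is concave and nondecreasing, and `x` is the smallest of `x`, `u` and `v`. If
  -- `c` truncates `u` or `v`, that term alone covers `y ⊓ c`.
  ⊓-concave : ∀ {x y u v} c → x ≤ u → x ≤ v → x + y ≤ u + v → (x ⊓ c) + (y ⊓ c) ≤ (u ⊓ c) + (v ⊓ c)
  ⊓-concave {x} {y} {u} {v} c x≤u x≤v le with ≤-total c u | ≤-total c v
  ... | inj₁ c≤u | _ = ≤-trans (+-mono-≤ (⊓-monoˡ-≤ c x≤v) (m⊓n≤n y c))
    (≤-reflexive (trans (+-comm (v ⊓ c) c) (cong (_+ (v ⊓ c)) (sym (m≥n⇒m⊓n≡n c≤u)))))
  ... | inj₂ _ | inj₁ c≤v = ≤-trans (+-mono-≤ (⊓-monoˡ-≤ c x≤u) (m⊓n≤n y c))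
    (≤-reflexive (cong ((u ⊓ c) +_) (sym (m≥n⇒m⊓n≡n c≤v))))
  ... | inj₂ u≤c | inj₂ v≤c = ≤-trans (≤-trans (+-mono-≤ (m⊓n≤m x c) (m⊓n≤m y c)) le)
    (≤-reflexive (sym (cong₂ _+_ (m≤n⇒m⊓n≡m u≤c) (m≤n⇒m⊓n≡m v≤c))))

  -- `ψ R m Z` is bounded by `∣ Z ∣ + ∣ ∁ Z ∣` and by `∣ R ∣ + m`. Reaching the first bound forces
  -- `Z ⊆ R`, reaching the second `R ⊆ Z`.
  ψ-tight : ∀ {R Z : Subset n} {m N} → ∣ Z ∣ + ∣ ∁ Z ∣ ≤ N → N ≤ ψ R m Z → ∣ R ∣ + m ≤ N → Z ≡ R
  ψ-tight {R = R} {Z} {m} {N} Z≤N N≤ψ R≤N = ⊆-antisym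
    (∣p─q∣≤0⇒p⊆q (+-cancelʳ-≤ ∣ Z ∩ R ∣ _ _ (≤-trans
      (count-≤ [] (∣ #0 :─ #1 ∣ᵉ :+ ∣ #0 :∩ #1 ∣ᵉ) ∣ #0 ∣ᵉ (Z ∷ R ∷ []) tt)
      (+-cancelʳ-≤ ∣ ∁ Z ∣ _ _ (≤-trans Z≤N (≤-trans N≤ψ (+-monoʳ-≤ ∣ Z ∩ R ∣ (m⊓n≤n m _))))))))
    (∣p─q∣≤0⇒p⊆q (+-cancelʳ-≤ ∣ Z ∩ R ∣ _ _ (≤-trans
      (count-≤ [] (∣ #1 :─ #0 ∣ᵉ :+ ∣ #0 :∩ #1 ∣ᵉ) ∣ #1 ∣ᵉ (Z ∷ R ∷ []) tt)
      (+-cancelʳ-≤ m _ _ (≤-trans R≤N (≤-trans N≤ψ (+-monoʳ-≤ ∣ Z ∩ R ∣ (m⊓n≤m m _))))))))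

  module _ {B : Subset n → Set} (exchange : Exchange B) (D A : Subset n) where

    -- An element of A in S stands for one more dummy, not for itself.
    φ : Subset n → ℕ → ∃[ Z ] B Z → Subset n → ℕ
    φ R m (Z , _) S = ψ (R ∪ S ∩ D) (m + ∣ S ∩ A ∣) Z

    -- Merging gives one member `Z` for `S ∩ T` and `S ∪ T`. For fixed `Z` the count of elements is
    -- modular in `S`, and the truncated count of dummies is submodular by `⊓-concave`.
    φ-submodular : ∀ R m → Submodular (φ R m)
    φ-submodular R m S T (Z₁ , b₁) (Z₂ , b₂) with merge exchange R⊆U m≤m′ b₁ b₂
      where
      R⊆U : R ∪ (S ∩ T) ∩ D ⊆ R ∪ (S ∪ T) ∩ D
      R⊆U = ∣p─q∣≤0⇒p⊆q (count-≤ [] ∣ (#0 :∪ (#1 :∩ #2) :∩ #3) :─ (#0 :∪ (#1 :∪ #2) :∩ #3) ∣ᵉ :0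
        (R ∷ S ∷ T ∷ D ∷ []) tt)
      m≤m′ : m + ∣ (S ∩ T) ∩ A ∣ ≤ m + ∣ (S ∪ T) ∩ A ∣
      m≤m′ = +-monoʳ-≤ m (count-≤ [] ∣ (#0 :∩ #1) :∩ #2 ∣ᵉ ∣ (#0 :∪ #1) :∩ #2 ∣ᵉ (S ∷ T ∷ A ∷ []) tt)
    ... | Z , b , le = (Z , b) , (begin
      φ R m (Z₁ , b₁) (S ∩ T) + φ R m (Z₂ , b₂) (S ∪ T)           ≤⟨ le ⟩
      φ R m (Z , b) (S ∩ T) + φ R m (Z , b) (S ∪ T)               ≡⟨ +-interchange ∣ Z ∩ (R ∪ (S ∩ T) ∩ D) ∣ _ _ _ ⟩
      (∣ Z ∩ (R ∪ (S ∩ T) ∩ D) ∣ + ∣ Z ∩ (R ∪ (S ∪ T) ∩ D) ∣) +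
      (((m + ∣ (S ∩ T) ∩ A ∣) ⊓ ∣ ∁ Z ∣) + ((m + ∣ (S ∪ T) ∩ A ∣) ⊓ ∣ ∁ Z ∣))
        ≤⟨ +-mono-≤
             (count-≤ [] (∣ #4 :∩ (#0 :∪ (#1 :∩ #2) :∩ #3) ∣ᵉ :+ ∣ #4 :∩ (#0 :∪ (#1 :∪ #2) :∩ #3) ∣ᵉ)
                         (∣ #4 :∩ (#0 :∪ #1 :∩ #3) ∣ᵉ :+ ∣ #4 :∩ (#0 :∪ #2 :∩ #3) ∣ᵉ)
                         (R ∷ S ∷ T ∷ D ∷ Z ∷ []) tt)
             (⊓-concave ∣ ∁ Z ∣
               (+-monoʳ-≤ m (count-≤ [] ∣ (#0 :∩ #1) :∩ #2 ∣ᵉ ∣ #0 :∩ #2 ∣ᵉ ρ tt))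
               (+-monoʳ-≤ m (count-≤ [] ∣ (#0 :∩ #1) :∩ #2 ∣ᵉ ∣ #1 :∩ #2 ∣ᵉ ρ tt))
               (subst₂ _≤_ (+-interchange m m _ _) (+-interchange m m _ _)
                 (+-monoʳ-≤ (m + m) (count-≤ [] (∣ (#0 :∩ #1) :∩ #2 ∣ᵉ :+ ∣ (#0 :∪ #1) :∩ #2 ∣ᵉ)
                   (∣ #0 :∩ #2 ∣ᵉ :+ ∣ #1 :∩ #2 ∣ᵉ) ρ tt)))) ⟩
      (∣ Z ∩ (R ∪ S ∩ D) ∣ + ∣ Z ∩ (R ∪ T ∩ D) ∣) +
      (((m + ∣ S ∩ A ∣) ⊓ ∣ ∁ Z ∣) + ((m + ∣ T ∩ A ∣) ⊓ ∣ ∁ Z ∣))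
        ≡⟨ +-interchange ∣ Z ∩ (R ∪ S ∩ D) ∣ _ _ _ ⟩
      φ R m (Z , b) S + φ R m (Z , b) T ∎)
      where
      open ≤-Reasoning
      ρ : Vec (Subset n) 3
      ρ = S ∷ T ∷ A ∷ []

  -- Exchange of several elements at once.

  module _ (em : ExcludedMiddle 0ℓ) {B : Subset n → Set} (exchange : Exchange B) where

    multiple-exchange : ∀ {X Y} → B X → B Y → ∀ I → I ⊆ (X ─ Y) →
      ∃[ J ] (J ⊆ (Y ─ X) × B ((X ─ I) ∪ J) × B ((Y ─ J) ∪ I))
    multiple-exchange {X} {Y} bX bY I I⊆ =
      result (split em (φ exchange D A R₁ m₁) (φ exchange D A R₂ m₂)
        (φ-submodular exchange D A R₁ m₁) (φ-submodular exchange D A R₂ m₂) (D ∪ A) c sufficient)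
      where
      A D R₁ R₂ : Subset n
      A = X ─ Y
      D = Y ─ X
      R₁ = X ─ I
      R₂ = X ∩ Y ∪ I

      m₁ m₂ N c : ℕ
      -- Filled up, `X` has `m₁` dummies and `Y` has `m₂ + ∣ A ∣`. Only `m₂` of them count as
      -- shared, so `Y` adds to `X` exactly `D` and dummies indexed by `A`.
      m₁ = ∣ ∁ X ∣
      m₂ = ∣ ∁ (X ∪ Y) ∣
      -- The size of the ground set, written as a cardinality so that `count-≤` can handle it.
      N  = ∣ X ∪ ∁ X ∣
      -- Chosen so that `∣ D ∪ A ∣ + c` is `N + N`, full rank for both functions.
      c  = N + ∣ X ∩ Y ∣ + m₂

      -- The variables stand for `X`, `Y`, `I`, then `S` or `J`, then a member `Z`.
      Aᵉ Dᵉ R₁ᵉ R₂ᵉ Nᵉ : Expr 5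
      Aᵉ = #0 :─ #1
      Dᵉ = #1 :─ #0
      R₁ᵉ = #0 :─ #2
      R₂ᵉ = #0 :∩ #1 :∪ #2
      Nᵉ = #0 :∪ ∁ᵉ #0

      cᵗ : Term 5
      cᵗ = ∣ Nᵉ ∣ᵉ :+ ∣ #0 :∩ #1 ∣ᵉ :+ ∣ ∁ᵉ (#0 :∪ #1) ∣ᵉ

      H : List (Inclusion 5)
      H = #2 :⊆ #0 :─ #1 ∷ []

      h : Hyps H (X ∷ Y ∷ I ∷ X ∷ Y ∷ [])
      -- `H` mentions only the first three variables, so this proof serves for every choice of the
      -- other two.
      h = I⊆ , tt

      -- Submodularity of the rank moves to X ∪ (S ∩ D) and (X ∩ Y) ∪ (S ∩ D),
      -- whose ranks are bounded below by the bases X and Y.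
      sufficient : Sufficient em (φ exchange D A R₁ m₁) (φ exchange D A R₂ m₂) (D ∪ A) c
      sufficient S with merge exchange {R = X ∩ Y ∪ S ∩ D} {X ∪ S ∩ D}
        (∣p─q∣≤0⇒p⊆q (count-≤ [] ∣ (#0 :∩ #1 :∪ #2 :∩ #3) :─ (#0 :∪ #2 :∩ #3) ∣ᵉ :0 (X ∷ Y ∷ S ∷ D ∷ []) tt))
        {m₂ + ∣ S ∩ A ∣} {m₁ + ∣ S ∩ A ∣}
        (+-monoˡ-≤ _ (count-≤ [] ∣ ∁ᵉ (#0 :∪ #1) ∣ᵉ ∣ ∁ᵉ #0 ∣ᵉ (X ∷ Y ∷ []) tt)) bY bX
      ... | Z , b , le = (Z , b) , (Z , b) , (begin
        ∣ S ∩ (D ∪ A) ∣ + c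
          ≤⟨ count-≤ [] (∣ #3 :∩ (Dᵉ :∪ Aᵉ) ∣ᵉ :+ cᵗ)
               (∣ #1 :∩ (#0 :∩ #1 :∪ #3 :∩ Dᵉ) ∣ᵉ :+ (∣ ∁ᵉ (#0 :∪ #1) ∣ᵉ :+ ∣ #3 :∩ Aᵉ ∣ᵉ) :+
                (∣ #0 :∩ (#0 :∪ #3 :∩ Dᵉ) ∣ᵉ :+ ∣ ∁ᵉ #0 ∣ᵉ)) ρ tt ⟩
        ∣ Y ∩ (X ∩ Y ∪ S ∩ D) ∣ + (m₂ + ∣ S ∩ A ∣) + (∣ X ∩ (X ∪ S ∩ D) ∣ + m₁)
          ≤⟨ +-mono-≤
               (+-monoʳ-≤ ∣ Y ∩ (X ∩ Y ∪ S ∩ D) ∣ (⊓-glb ≤-refl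
                 (count-≤ [] (∣ ∁ᵉ (#0 :∪ #1) ∣ᵉ :+ ∣ #3 :∩ Aᵉ ∣ᵉ) ∣ ∁ᵉ #1 ∣ᵉ ρ tt)))
               (+-monoʳ-≤ ∣ X ∩ (X ∪ S ∩ D) ∣ (⊓-glb (m≤m+n m₁ _) ≤-refl)) ⟩
        ψ (X ∩ Y ∪ S ∩ D) (m₂ + ∣ S ∩ A ∣) Y + ψ (X ∪ S ∩ D) (m₁ + ∣ S ∩ A ∣) X
          ≤⟨ le ⟩
        ψ (X ∩ Y ∪ S ∩ D) (m₂ + ∣ S ∩ A ∣) Z + ψ (X ∪ S ∩ D) (m₁ + ∣ S ∩ A ∣) Z
          ≡⟨ +-interchange ∣ Z ∩ (X ∩ Y ∪ S ∩ D) ∣ _ _ _ ⟩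
        (∣ Z ∩ (X ∩ Y ∪ S ∩ D) ∣ + ∣ Z ∩ (X ∪ S ∩ D) ∣) + (((m₂ + ∣ S ∩ A ∣) ⊓ ∣ ∁ Z ∣) + ((m₁ + ∣ S ∩ A ∣) ⊓ ∣ ∁ Z ∣))
          -- Since `I ⊆ X ─ Y`, the sets `R₁` and `R₂` have union `X` and intersection `X ∩ Y`.
          ≤⟨ +-mono-≤ (count-≤ H
               (∣ #4 :∩ (#0 :∩ #1 :∪ #3 :∩ Dᵉ) ∣ᵉ :+ ∣ #4 :∩ (#0 :∪ #3 :∩ Dᵉ) ∣ᵉ)
               (∣ #4 :∩ (R₁ᵉ :∪ #3 :∩ Dᵉ) ∣ᵉ :+ ∣ #4 :∩ (R₂ᵉ :∪ #3 :∩ Dᵉ) ∣ᵉ) ρ h)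
               (≤-reflexive (+-comm ((m₂ + ∣ S ∩ A ∣) ⊓ ∣ ∁ Z ∣) _)) ⟩
        (∣ Z ∩ (R₁ ∪ S ∩ D) ∣ + ∣ Z ∩ (R₂ ∪ S ∩ D) ∣) + (((m₁ + ∣ S ∩ A ∣) ⊓ ∣ ∁ Z ∣) + ((m₂ + ∣ S ∩ A ∣) ⊓ ∣ ∁ Z ∣))
          ≡⟨ +-interchange ∣ Z ∩ (R₁ ∪ S ∩ D) ∣ _ _ _ ⟩
        φ exchange D A R₁ m₁ (Z , b) S + φ exchange D A R₂ m₂ (Z , b) S ∎)
        where
        open ≤-Reasoning
        ρ : Vec (Subset n) 5
        ρ = X ∷ Y ∷ I ∷ S ∷ Z ∷ []

      result : ∃[ J ] ∃[ z₁ ] ∃[ z₂ ] ∣ D ∪ A ∣ + c ≤ φ exchange D A R₁ m₁ z₁ J + φ exchange D A R₂ m₂ z₂ (∁ J) →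
        ∃[ J ] (J ⊆ D × B ((X ─ I) ∪ J) × B ((Y ─ J) ∪ I))
      -- Only `J ∩ D` consists of genuine elements; the rest of `J` that counts lies in `A` and
      -- stands for dummies.
      result (J , (Z₁ , b₁) , (Z₂ , b₂) , le) = J ∩ D , p∩q⊆q J D ,
        subst B (ψ-tight (total Z₁) N≤φ₁ size₁≤N) b₁ ,
        subst B (trans (ψ-tight (total Z₂) N≤φ₂ size₂≤N) (⊆-antisym
          (∣p─q∣≤0⇒p⊆q (count-≤ H ∣ (R₂ᵉ :∪ ∁ᵉ #3 :∩ Dᵉ) :─ Y′ᵉ ∣ᵉ :0 (ρ Z₂) h))
          (∣p─q∣≤0⇒p⊆q (count-≤ H ∣ Y′ᵉ :─ (R₂ᵉ :∪ ∁ᵉ #3 :∩ Dᵉ) ∣ᵉ :0 (ρ Z₂) h)))) b₂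
        where
        ρ : Subset n → Vec (Subset n) 5
        ρ Z = X ∷ Y ∷ I ∷ J ∷ Z ∷ []

        Y′ᵉ : Expr 5
        Y′ᵉ = (#1 :─ #3 :∩ Dᵉ) :∪ #2

        φ₁ φ₂ size₁ size₂ : ℕ
        φ₁ = φ exchange D A R₁ m₁ (Z₁ , b₁) J
        φ₂ = φ exchange D A R₂ m₂ (Z₂ , b₂) (∁ J)
        size₁ = ∣ R₁ ∪ J ∩ D ∣ + (m₁ + ∣ J ∩ A ∣)
        size₂ = ∣ R₂ ∪ ∁ J ∩ D ∣ + (m₂ + ∣ ∁ J ∩ A ∣)

        total : ∀ Z → ∣ Z ∣ + ∣ ∁ Z ∣ ≤ N
        total Z = count-≤ [] (∣ #4 ∣ᵉ :+ ∣ ∁ᵉ #4 ∣ᵉ) ∣ Nᵉ ∣ᵉ (ρ Z) tt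

        ψ≤N : ∀ R m Z → ψ R m Z ≤ N
        ψ≤N R m Z = ≤-trans (+-mono-≤ (p⊆q⇒∣p∣≤∣q∣ (p∩q⊆p Z R)) (m⊓n≤n m _)) (total Z)

        ψ≤size : ∀ R m Z → ψ R m Z ≤ ∣ R ∣ + m
        ψ≤size R m Z = +-mono-≤ (p⊆q⇒∣p∣≤∣q∣ (p∩q⊆q Z R)) (m⊓n≤m m _)

        N+N≤φ₁+φ₂ : N + N ≤ φ₁ + φ₂
        N+N≤φ₁+φ₂ = ≤-trans
          (count-≤ [] (∣ Nᵉ ∣ᵉ :+ ∣ Nᵉ ∣ᵉ) (∣ Dᵉ :∪ Aᵉ ∣ᵉ :+ cᵗ) (ρ Z₁) tt) le

        N≤φ₁ : N ≤ φ₁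
        -- Neither value exceeds `N`, so a sum of at least `N + N` forces both to reach it.
        N≤φ₁ = +-cancelʳ-≤ N _ _ (≤-trans N+N≤φ₁+φ₂ (+-monoʳ-≤ φ₁ (ψ≤N _ _ Z₂)))

        N≤φ₂ : N ≤ φ₂
        N≤φ₂ = +-cancelˡ-≤ N _ _ (≤-trans N+N≤φ₁+φ₂ (+-monoˡ-≤ φ₂ (ψ≤N _ _ Z₁)))

        sizes : size₁ + size₂ ≤ N + N
        sizes = count-≤ H
          (∣ R₁ᵉ :∪ #3 :∩ Dᵉ ∣ᵉ :+ (∣ ∁ᵉ #0 ∣ᵉ :+ ∣ #3 :∩ Aᵉ ∣ᵉ) :+
           (∣ R₂ᵉ :∪ ∁ᵉ #3 :∩ Dᵉ ∣ᵉ :+ (∣ ∁ᵉ (#0 :∪ #1) ∣ᵉ :+ ∣ ∁ᵉ #3 :∩ Aᵉ ∣ᵉ)))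
          (∣ Nᵉ ∣ᵉ :+ ∣ Nᵉ ∣ᵉ) (ρ Z₁) h

        size₁≤N : size₁ ≤ N
        -- Dually, each size is at least the value it bounds, hence at least `N`, which leaves at
        -- most `N` for the other.
        size₁≤N = +-cancelʳ-≤ N _ _ (≤-trans (+-monoʳ-≤ size₁ (≤-trans N≤φ₂ (ψ≤size _ _ Z₂))) sizes)

        size₂≤N : size₂ ≤ N
        size₂≤N = +-cancelˡ-≤ N _ _ (≤-trans (+-monoˡ-≤ size₂ (≤-trans N≤φ₁ (ψ≤size _ _ Z₁))) sizes)

open import Defs
open import Axiom.ExcludedMiddle using (ExcludedMiddle)
open import Data.Fin.Base using (Fin)
open import Data.Fin.Subset using (Subset; _⊆_; _─_; _∪_)
open import Data.Fin.Subset using (_-_; ⁅_⁆) renaming (_∈_ to _∈ˢ_)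
open import Data.Fin.Subset.Properties using (_∈?_)
open import Data.List.Base using (_∷_; allFin)
open import Data.List.Membership.Propositional using () renaming (_∈_ to _∈ˡ_)
open import Data.List.Membership.Propositional.Properties using (∈-filter⁻; ∈-map⁻)
open import Data.List.Relation.Unary.Any using (here; there)
open import Data.Nat.Base using (ℕ)
import Data.Nat.Base as ℕ
import Data.Nat.Properties as ℕ
open import Data.Product.Base using (_×_; ∃-syntax)
open import Data.Product.Base using (_,_; proj₁; proj₂)
open import Data.Rational.Base as ℚ using (ℚ; 0ℚ; ½; ∣_∣)
import Data.Rational.Properties as ℚ
open import Data.Rational.Solver using (module +-*-Solver)
open import Data.Sum.Base as Sum using (_⊎_; inj₁; inj₂)
open import Level using (0ℓ)
open import Relation.Binary.Construct.Add.Infimum.NonStrict _≤ᴿ_ using ([_]; ≤₋-trans)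
open import Relation.Binary.PropositionalEquality
open import Relation.Nullary.Construct.Add.Infimum using (⊥₋; [_])
open import Relation.Nullary.Decidable.Core using (yes; no)
open import Relation.Nullary.Negation using (¬_; contradiction)
open import Relation.Unary using (_∈_)

open MultipleExchange using (Exchange; multiple-exchange)

private variable
  n : ℕ

-- Order and addition of real numbers.

½+½ : ∀ ε → ½ ℚ.* ε ℚ.+ ½ ℚ.* ε ≡ ε
½+½ = solve 1 (λ e → con ½ :* e :+ con ½ :* e := e) refl
  where open +-*-Solver

½-pos : ∀ {ε} → 0ℚ ℚ.< ε → 0ℚ ℚ.< ½ ℚ.* ε
½-pos {ε} 0<ε = subst (ℚ._< ½ ℚ.* ε) (ℚ.*-zeroʳ ½) (ℚ.*-monoʳ-<-pos ½ 0<ε)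

near⇒≤ : ∀ a b {ε} → ∣ a ℚ.- b ∣ ℚ.≤ ε → a ℚ.≤ b ℚ.+ ε
near⇒≤ a b {ε} h = begin
  a                        ≡⟨ cancel a b ⟩
  b ℚ.+ (a ℚ.- b)          ≤⟨ ℚ.+-monoʳ-≤ b (p≤∣p∣ (a ℚ.- b)) ⟩
  b ℚ.+ ∣ a ℚ.- b ∣        ≤⟨ ℚ.+-monoʳ-≤ b h ⟩
  b ℚ.+ ε                  ∎
  where
  open ℚ.≤-Reasoning
  open +-*-Solver
  cancel : ∀ a b → a ≡ b ℚ.+ (a ℚ.- b)
  cancel = solve 2 (λ a b → a := b :+ (a :- b)) refl
  p≤∣p∣ : ∀ p → p ℚ.≤ ∣ p ∣
  p≤∣p∣ p with ℚ.≤-total 0ℚ p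
  ... | inj₁ 0≤p = ℚ.≤-reflexive (sym (ℚ.0≤p⇒∣p∣≡p 0≤p))
  ... | inj₂ p≤0 = ℚ.≤-trans p≤0 (ℚ.0≤∣p∣ p)

≤ᴿ-trans : ∀ {x y z} → x ≤ᴿ y → y ≤ᴿ z → x ≤ᴿ z
≤ᴿ-trans {x} {y} {z} x≤y y≤z ε 0<ε
  with x≤y (½ ℚ.* ε) (½-pos 0<ε) | y≤z (½ ℚ.* ε) (½-pos 0<ε)
... | M , p | N , q = M ℕ.⊔ N , λ k k≥ → begin
  seq x k                                     ≤⟨ p k (ℕ.m⊔n≤o⇒m≤o M N k≥) ⟩
  seq y k ℚ.+ ½ ℚ.* ε                         ≤⟨ ℚ.+-monoˡ-≤ (½ ℚ.* ε) (q k (ℕ.m⊔n≤o⇒n≤o M N k≥)) ⟩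
  (seq z k ℚ.+ ½ ℚ.* ε) ℚ.+ ½ ℚ.* ε           ≡⟨ ℚ.+-assoc (seq z k) _ _ ⟩
  seq z k ℚ.+ (½ ℚ.* ε ℚ.+ ½ ℚ.* ε)           ≡⟨ cong (seq z k ℚ.+_) (½+½ ε) ⟩
  seq z k ℚ.+ ε                               ∎
  where open ℚ.≤-Reasoning

+ᴿ-comm-≤ : ∀ x y → x +ᴿ y ≤ᴿ y +ᴿ x
+ᴿ-comm-≤ x y ε 0<ε = 0 , λ k _ → ℚ.≤-trans (ℚ.≤-reflexive
  (trans (ℚ.+-comm (seq x k) (seq y k)) (sym (ℚ.+-identityʳ _))))
  (ℚ.+-monoʳ-≤ (seq y k ℚ.+ seq x k) (ℚ.<⇒≤ 0<ε))

+ᴿ-cancel-≤ : ∀ {x y p q} → x +ᴿ y ≤ᴿ p +ᴿ q → q ≤ᴿ y → x ≤ᴿ p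
+ᴿ-cancel-≤ {x} {y} {p} {q} le q≤y ε 0<ε
  with le (½ ℚ.* ε) (½-pos 0<ε) | q≤y (½ ℚ.* ε) (½-pos 0<ε)
... | M , u | N , v = M ℕ.⊔ N , λ k k≥ → bound k
    (u k (ℕ.m⊔n≤o⇒m≤o M N k≥)) (v k (ℕ.m⊔n≤o⇒n≤o M N k≥))
  where
  open ℚ.≤-Reasoning
  open +-*-Solver
  e₁ : ∀ a b → a ≡ (a ℚ.+ b) ℚ.- b
  e₁ = solve 2 (λ a b → a := (a :+ b) :- b) refl
  e₂ : ∀ a b h → ((a ℚ.+ (b ℚ.+ h)) ℚ.+ h) ℚ.- b ≡ a ℚ.+ (h ℚ.+ h)
  e₂ = solve 3 (λ a b h → ((a :+ (b :+ h)) :+ h) :- b := a :+ (h :+ h)) refl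
  bound : ∀ k → seq x k ℚ.+ seq y k ℚ.≤ (seq p k ℚ.+ seq q k) ℚ.+ ½ ℚ.* ε →
    seq q k ℚ.≤ seq y k ℚ.+ ½ ℚ.* ε → seq x k ℚ.≤ seq p k ℚ.+ ε
  bound k u v = begin
    seq x k                                   ≡⟨ e₁ (seq x k) (seq y k) ⟩
    (seq x k ℚ.+ seq y k) ℚ.- seq y k         ≤⟨ ℚ.+-monoˡ-≤ (ℚ.- seq y k) u ⟩
    ((seq p k ℚ.+ seq q k) ℚ.+ ½ ℚ.* ε) ℚ.- seq y k
      ≤⟨ ℚ.+-monoˡ-≤ (ℚ.- seq y k) (ℚ.+-monoˡ-≤ (½ ℚ.* ε) (ℚ.+-monoʳ-≤ (seq p k) v)) ⟩
    ((seq p k ℚ.+ (seq y k ℚ.+ ½ ℚ.* ε)) ℚ.+ ½ ℚ.* ε) ℚ.- seq y k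
                                              ≡⟨ e₂ (seq p k) (seq y k) (½ ℚ.* ε) ⟩
    seq p k ℚ.+ (½ ℚ.* ε ℚ.+ ½ ℚ.* ε)         ≡⟨ cong (seq p k ℚ.+_) (½+½ ε) ⟩
    seq p k ℚ.+ ε                             ∎

-- Comparison with maxima, using excluded middle.

module _ (em : ExcludedMiddle 0ℓ) where

  ≰ᴿ⇒gap : ∀ {x y} → ¬ x ≤ᴿ y →
    ∃[ ε ] (0ℚ ℚ.< ε × (∀ N → ∃[ k ] (N ℕ.≤ k × seq y k ℚ.+ ε ℚ.< seq x k)))
  ≰ᴿ⇒gap {x} {y} x≰y with em {∃[ ε ] (0ℚ ℚ.< ε × (∀ N → ∃[ k ] (N ℕ.≤ k × seq y k ℚ.+ ε ℚ.< seq x k)))}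
  ... | yes gap  = gap
  ... | no  ¬gap = contradiction x≤y x≰y
    where
    x≤y : x ≤ᴿ y
    x≤y ε 0<ε with em {∃[ N ] (∀ k → N ℕ.≤ k → seq x k ℚ.≤ seq y k ℚ.+ ε)}
    ... | yes le  = le
    ... | no  ¬le = contradiction (ε , 0<ε , often) ¬gap
      where
      often : ∀ N → ∃[ k ] (N ℕ.≤ k × seq y k ℚ.+ ε ℚ.< seq x k)
      often N with em {∃[ k ] (N ℕ.≤ k × seq y k ℚ.+ ε ℚ.< seq x k)}
      ... | yes k  = k
      ... | no  ¬k = contradiction (N , λ k N≤k → ℚ.≮⇒≥ λ lt → ¬k (k , N≤k , lt)) ¬le

  -- The gap is known only at arbitrarily late indices; the Cauchy property spreads it to all late
  -- ones. A quarter of it is spent on `x` and a quarter on `y`, so half survives.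
  ≰ᴿ⇒eventually≰ : ∀ {x y} → ¬ x ≤ᴿ y →
    ∃[ ε ] (0ℚ ℚ.< ε × ∃[ N ] (∀ k → N ℕ.≤ k → ¬ seq x k ℚ.≤ seq y k ℚ.+ ε))
  ≰ᴿ⇒eventually≰ {x} {y} x≰y with ≰ᴿ⇒gap {x} {y} x≰y
  ... | ε , 0<ε , often
    with cauchy x (½ ℚ.* (½ ℚ.* ε)) (½-pos (½-pos 0<ε)) | cauchy y (½ ℚ.* (½ ℚ.* ε)) (½-pos (½-pos 0<ε))
  ... | M , x-near | N , y-near with often (M ℕ.⊔ N)
  ... | l , l≥ , y+ε<x = ½ ℚ.* ε , ½-pos 0<ε , M ℕ.⊔ N , λ k k≥ x≤y+½ε → ℚ.<-irrefl refl (begin-strict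
    seq y l ℚ.+ ε                             <⟨ y+ε<x ⟩
    seq x l
      ≤⟨ near⇒≤ (seq x l) (seq x k) (x-near l k (ℕ.m⊔n≤o⇒m≤o M N l≥) (ℕ.m⊔n≤o⇒m≤o M N k≥)) ⟩
    seq x k ℚ.+ η                             ≤⟨ ℚ.+-monoˡ-≤ η x≤y+½ε ⟩
    (seq y k ℚ.+ ½ ℚ.* ε) ℚ.+ η
      ≤⟨ ℚ.+-monoˡ-≤ η (ℚ.+-monoˡ-≤ (½ ℚ.* ε) (near⇒≤ (seq y k) (seq y l)
           (y-near k l (ℕ.m⊔n≤o⇒n≤o M N k≥) (ℕ.m⊔n≤o⇒n≤o M N l≥)))) ⟩
    ((seq y l ℚ.+ η) ℚ.+ ½ ℚ.* ε) ℚ.+ η       ≡⟨ quarters (seq y l) ε ⟩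
    seq y l ℚ.+ ε                             ∎)
    where
    open ℚ.≤-Reasoning
    open +-*-Solver
    η : ℚ
    η = ½ ℚ.* (½ ℚ.* ε)
    quarters : ∀ a e → ((a ℚ.+ ½ ℚ.* (½ ℚ.* e)) ℚ.+ ½ ℚ.* e) ℚ.+ ½ ℚ.* (½ ℚ.* e) ≡ a ℚ.+ e
    quarters = solve 2 (λ a e → ((a :+ con ½ :* (con ½ :* e)) :+ con ½ :* e) :+ con ½ :* (con ½ :* e)
      := a :+ e) refl

  -- If `x ≤ᴿ y` fails, a fixed gap `ε` eventually rules out the entry of `y` as the maximum. The
  -- entry of `z` is then the maximum, whatever accuracy `δ` is asked for.
  ≤ᴿ-⊔ᴿ : ∀ {x y z} → x ≤ᴿ y ⊔ᴿ z → x ≤ᴿ y ⊎ x ≤ᴿ z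
  ≤ᴿ-⊔ᴿ {x} {y} {z} le with em {x ≤ᴿ y}
  ... | yes x≤y = inj₁ x≤y
  ... | no  x≰y = inj₂ (x≤z (≰ᴿ⇒eventually≰ {x} {y} x≰y))
    where
    choose : ∀ k {ε δ} → ¬ seq x k ℚ.≤ seq y k ℚ.+ ε →
      seq x k ℚ.≤ (seq y k ℚ.⊔ seq z k) ℚ.+ ε → seq x k ℚ.≤ (seq y k ℚ.⊔ seq z k) ℚ.+ δ →
      seq x k ℚ.≤ seq z k ℚ.+ δ
    choose k {ε} {δ} x≰y+ε le-ε le-δ = Sum.[
        (λ ≡y → contradiction (subst (λ a → seq x k ℚ.≤ a ℚ.+ ε) ≡y le-ε) x≰y+ε) ,
        (λ ≡z → subst (λ a → seq x k ℚ.≤ a ℚ.+ δ) ≡z le-δ)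
      ] (ℚ.⊔-sel (seq y k) (seq z k))

    x≤z : ∃[ ε ] (0ℚ ℚ.< ε × ∃[ N ] (∀ k → N ℕ.≤ k → ¬ seq x k ℚ.≤ seq y k ℚ.+ ε)) → x ≤ᴿ z
    x≤z (ε , 0<ε , N , x≰y+ε) δ 0<δ =
      let M , le-ε = le ε 0<ε
          L , le-δ = le δ 0<δ
      in (N ℕ.⊔ M) ℕ.⊔ L , λ k k≥ →
        let NM≤k = ℕ.m⊔n≤o⇒m≤o (N ℕ.⊔ M) L k≥ in
        choose k (x≰y+ε k (ℕ.m⊔n≤o⇒m≤o N M NM≤k)) (le-ε k (ℕ.m⊔n≤o⇒n≤o N M NM≤k))
          (le-δ k (ℕ.m⊔n≤o⇒n≤o (N ℕ.⊔ M) L k≥))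

  ≤-⊔ : ∀ {x} a b → [ x ] ≤ a ⊔ b → [ x ] ≤ a ⊎ [ x ] ≤ b
  ≤-⊔ {x} [ y ] [ z ] [ le ] = Sum.map [_] [_] (≤ᴿ-⊔ᴿ {x} {y} {z} le)
  ≤-⊔ [ y ] ⊥₋    le     = inj₁ le
  ≤-⊔ ⊥₋    b     le     = inj₂ le

  ≤-max : ∀ {x} as → [ x ] ≤ max as → ∃[ a ] (a ∈ˡ as × [ x ] ≤ a)
  -- The empty list cannot occur: its maximum is -∞, and no finite value lies below that.
  ≤-max (a ∷ as) le with ≤-⊔ a (max as) le
  ... | inj₁ x≤a = a , here refl , x≤a
  ... | inj₂ x≤m with ≤-max as x≤m
  ...   | b , b∈ , x≤b = b , there b∈ , x≤b

  ≤-max-over : ∀ {x} (g : Fin n → ℝ₋∞) S → [ x ] ≤ max-over g S → ∃[ j ] (j ∈ˢ S × [ x ] ≤ g j)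
  ≤-max-over g S le with ≤-max _ le
  ... | a , a∈ , x≤a with ∈-map⁻ g a∈
  ... | j , j∈ , refl = j , proj₂ (∈-filter⁻ (_∈? S) {xs = allFin _} j∈) , x≤a

  -- Maximizers of an M♮-concave function.

  module _ {f : Subset n → ℝ₋∞} (f-concave : M♮-concave f) where
    open M♮-concave f-concave

    -- A maximizer lies above a point of the nonempty domain. Finiteness is what permits
    -- cancellation in sums of values.
    max-finite : ∀ {X} → X ∈ argmax f → ∃[ x ] f X ≡ [ x ]
    max-finite {X} X-max with dom-nonempty | f X | X-max
    ... | Z , fZ≢-∞ | [ x ] | _  = x , refl
    ... | Z , fZ≢-∞ | ⊥₋    | ub with f Z | fZ≢-∞ | ub Z
    ...   | ⊥₋ | fZ≢ | _ = contradiction refl fZ≢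
    ...   | [ z ] | _ | ()

    argmax-upward : ∀ {X P} → X ∈ argmax f → f X ≤ f P → P ∈ argmax f
    argmax-upward X-max fX≤fP Z = ≤₋-trans (λ {x} {y} {z} → ≤ᴿ-trans {x} {y} {z}) (X-max Z) fX≤fP

    -- Maximality gives `f P ≤ f X` and `f Q ≤ f Y`, so neither summand can fall short without the
    -- sum doing so.
    both-max : ∀ {X Y P Q} → X ∈ argmax f → Y ∈ argmax f →
      f X + f Y ≤ f P + f Q → P ∈ argmax f × Q ∈ argmax f
    both-max {X} {Y} {P} {Q} X-max Y-max le with max-finite X-max | max-finite Y-max
    ... | x , fX≡x | y , fY≡y = argmax-upward X-max (proj₁ parts) , argmax-upward Y-max (proj₂ parts)
      where
      cancel : ∀ {a b} → [ x +ᴿ y ] ≤ a + b → a ≤ [ x ] → b ≤ [ y ] → [ x ] ≤ a × [ y ] ≤ b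
      cancel {[ p ]} {[ q ]} [ le ] [ p≤x ] [ q≤y ] =
        [ +ᴿ-cancel-≤ {x} {y} {p} {q} le q≤y ] ,
        [ +ᴿ-cancel-≤ {y} {x} {q} {p}
            (≤ᴿ-trans {y +ᴿ x} {x +ᴿ y} {q +ᴿ p} (+ᴿ-comm-≤ y x)
              (≤ᴿ-trans {x +ᴿ y} {p +ᴿ q} {q +ᴿ p} le (+ᴿ-comm-≤ p q))) p≤x ]
      parts : f X ≤ f P × f Y ≤ f Q
      parts = subst₂ (λ a b → a ≤ f P × b ≤ f Q) (sym fX≡x) (sym fY≡y)
        (cancel (subst₂ (λ a b → a + b ≤ f P + f Q) fX≡x fY≡y le)
          (subst (f P ≤_) fX≡x (X-max P)) (subst (f Q ≤_) fY≡y (Y-max Q)))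

    -- The finite value `f X + f Y` lies below one alternative of the exchange inequality, and
    -- `both-max` makes both sets of that alternative maximizers.
    argmax-exchange : Exchange (argmax f)
    argmax-exchange {X} {Y} X-max Y-max i i∈
      with max-finite X-max | max-finite Y-max
    ... | x , fX≡x | y , fY≡y = Sum.map (λ le → both-max X-max Y-max (to-sum le)) swapped
      (≤-⊔ (f (X - i) + f (Y ∪ ⁅ i ⁆)) (max-over swap-value (Y ─ X))
        (from-sum (exchange X Y i i∈)))
      where
      swap-value : Fin _ → ℝ₋∞
      swap-value j = f ((X - i) ∪ ⁅ j ⁆) + f ((Y ∪ ⁅ i ⁆) - j)

      fX+fY≡x+y : f X + f Y ≡ [ x +ᴿ y ]
      fX+fY≡x+y = cong₂ _+_ fX≡x fY≡y

      to-sum : ∀ {a} → [ x +ᴿ y ] ≤ a → f X + f Y ≤ a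
      to-sum {a} = subst (_≤ a) (sym fX+fY≡x+y)

      from-sum : ∀ {a} → f X + f Y ≤ a → [ x +ᴿ y ] ≤ a
      from-sum {a} = subst (_≤ a) fX+fY≡x+y

      swapped : [ x +ᴿ y ] ≤ max-over swap-value (Y ─ X) →
        ∃[ j ] (j ∈ˢ (Y ─ X) × ((X - i) ∪ ⁅ j ⁆) ∈ argmax f × ((Y ∪ ⁅ i ⁆) - j) ∈ argmax f)
      swapped le with ≤-max-over swap-value (Y ─ X) le
      ... | j , j∈ , le′ = j , j∈ , both-max X-max Y-max (to-sum le′)

theorem2 : ExcludedMiddle 0ℓ →
    ∀ (n : ℕ) (f : Subset n → ℝ₋∞) → M♮-concave f →
    ∀ (X Y : Subset n) → X ∈ argmax f → Y ∈ argmax f →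
    ∀ (I : Subset n) → I ⊆ (X ─ Y) →
    ∃[ J ] (J ⊆ (Y ─ X) × ((X ─ I) ∪ J) ∈ argmax f × ((Y ─ J) ∪ I) ∈ argmax f)
theorem2 em n f f-concave X Y X-max Y-max =
  multiple-exchange em (argmax-exchange em f-concave) X-max Y-max
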